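{- There are no $H$-palindromic trees of odd diameter; that is, no finite tree $T$ whose diameter $D$ is odd satisfies $\alpha(T,k)=\alpha(T,D-k)$ for all $k=0,1,\dots,\lfloor D/2\rfloor$.
   Context: The distance $d(x,y)$ between two vertices of a connected graph is the number of edges in a shortest path connecting them, and the diameter $D$ is the maximal distance between vertices. For a finite connected simple graph $G$ of diameter $D$ and $0\le k\le D$, $\alpha(G,k)$ denotes the number of unordered pairs of (not necessarily distinct) vertices of $G$ at distance $k$; in particular $\alpha(G,0)=|V(G)|$ and $\alpha(G,1)=|E(G)|$. The graph $G$ is called $H$-palindromic if $\alpha(G,k)=\alpha(G,D-k)$ for all $k=0,1,\dots,\lfloor D/2\rfloor$. -}

module Defs where

open import Data.Fin.Base using (Fin)
open import Data.Fin.Properties using (_≟_; any?) renaming (_≤?_ to _≤ᶠ?_)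
open import Data.List.Base using (List; length; filter; cartesianProduct; allFin)
open import Data.Nat.Base using (ℕ; zero; suc; _≤_; _∸_; ⌊_/2⌋)
open import Data.Nat.Properties using (allUpTo?; ≮⇒≥; <⇒≱)
open import Data.Product.Base using (∃; ∃-syntax; _×_; _,_; uncurry)
open import Data.Vec.Base using (Vec; []; _∷_; head; last)
open import Data.Vec.Relation.Unary.AllPairs using (allPairs?)
open import Data.Vec.Relation.Unary.Linked using (Linked; linked?)
open import Data.Vec.Relation.Unary.Unique.Propositional using (Unique)
open import Level using (0ℓ)
open import Relation.Binary.Core using (Rel)
open import Relation.Binary.Definitions using (Decidable; Symmetric; Irreflexive)
open import Relation.Binary.PropositionalEquality.Core using (_≡_)
open import Relation.Nullary.Decidable using (Dec; map′; _×-dec_; ¬?)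
open import Relation.Nullary.Negation using (¬_)
open import Relation.Unary using (Pred) renaming (Decidable to Decidable₁)

record Graph (n : ℕ) : Set₁ where
  field
    Adj        : Rel (Fin n) 0ℓ
    adj?       : Decidable Adj
    adj-sym    : Symmetric Adj
    adj-irrefl : Irreflexive _≡_ Adj

anyVec? : ∀ {n} k {P : Pred (Vec (Fin n) k) 0ℓ} → Decidable₁ P → Dec (∃ P)
anyVec? zero    P? = map′ ([] ,_) (λ { ([] , p) → p }) (P? [])
anyVec? (suc k) P? =
  map′ (λ (x , xs , p) → x ∷ xs , p) (λ { (x ∷ xs , p) → x , xs , p })
       (any? λ x → anyVec? k λ xs → P? (x ∷ xs))

module _ {n : ℕ} (G : Graph n) where
  open Graph G

  -- A path with k edges is given by its sequence of k + 1 distinct vertices.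
  IsPath : ∀ (x y : Fin n) {k} → Vec (Fin n) (suc k) → Set
  IsPath x y v = head v ≡ x × last v ≡ y × Linked Adj v × Unique v

  Path : Fin n → Fin n → ℕ → Set
  Path x y k = ∃[ v ] IsPath x y {k} v

  -- d(x,y) = k
  Distance : Fin n → Fin n → ℕ → Set
  Distance x y k = Path x y k × (∀ {j} → Path x y j → k ≤ j)

  Connected : Set
  Connected = ∀ x y → ∃[ k ] Path x y k

  -- A cycle is given by its cyclic sequence of k + 3 distinct vertices.
  IsCycle : ∀ {k} → Vec (Fin n) (suc (suc (suc k))) → Set
  IsCycle v = Linked Adj v × Adj (last v) (head v) × Unique v

  Acyclic : Set
  Acyclic = ∀ {k} (v : Vec (Fin n) (suc (suc (suc k)))) → ¬ IsCycle v

  record IsTree : Set where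
    field
      connected : Connected
      acyclic   : Acyclic

  HasDiameter : ℕ → Set
  HasDiameter D =
    (∃[ x ] ∃[ y ] Distance x y D) × (∀ {x y k} → Distance x y k → k ≤ D)

  path? : ∀ x y k → Dec (Path x y k)
  path? x y k = anyVec? (suc k) λ v →
    head v ≟ x ×-dec last v ≟ y ×-dec linked? adj? v ×-dec
    allPairs? (λ a b → ¬? (a ≟ b)) v

  distance? : ∀ x y k → Dec (Distance x y k)
  distance? x y k = path? x y k ×-dec
    map′ (λ none p → ≮⇒≥ λ j<k → none j<k p)
         (λ min {j} j<k p → <⇒≱ j<k (min p))
         (allUpTo? (λ j → ¬? (path? x y j)) k)

  -- The unordered pair {x, y}, possibly with x = y, is represented by the
  -- ordered pair (x , y) with x ≤ y.
  unorderedPairs : List (Fin n × Fin n)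
  unorderedPairs = filter (uncurry _≤ᶠ?_) (cartesianProduct (allFin n) (allFin n))

  α : ℕ → ℕ
  α k = length (filter (λ (x , y) → distance? x y k) unorderedPairs)

  -- D is meant to be the diameter of G.
  HPalindromic : ℕ → Set
  HPalindromic D = ∀ k → k ≤ ⌊ D /2⌋ → α k ≡ α (D ∸ k)

{-# OPTIONS --safe #-}

-- An acyclic graph has no odd closed walk, so in a tree there are signs
-- s x = ±1 with (-1)^d(x,y) = s x · s y.  Hence the alternating sum
-- Z = Σₖ (-1)^k α(T,k) equals Σ_{x≤y} s x · s y, and 2Z = (Σ s)² + n > 0.
-- When D is odd, palindromicity pairs the terms k and D - k of Z with
-- opposite signs, which forces Z = 0.
module Submission where

open import Defs
import Algebra.Properties.Semiring.Sum
open import Data.Bool.Base using (true; false; if_then_else_)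
open import Data.Fin.Base as Fin using (Fin; zero; suc; toℕ; fromℕ<; opposite)
open import Data.Fin.Permutation using (reverse)
open import Data.Fin.Properties as Fin using (_≟_; toℕ-fromℕ<; toℕ-injective; toℕ≤pred[n]; opposite-prop)
open import Data.Integer.Base using (ℤ; +_; -[1+_]; +[1+_]; 0ℤ; 1ℤ; -1ℤ; -_; _+_; _*_; ∣_∣)
open import Data.Integer.Properties using (+-*-semiring; +-identityˡ; +-identityʳ; +-assoc; +-injective; *-assoc; *-identityˡ; *-identityʳ; *-zeroˡ; *-zeroʳ; neg-distribˡ-*; -1*i≡-i)
open import Data.Integer.Tactic.RingSolver using (solve-∀)
open import Data.List.Base as List using (List; []; _∷_; _++_; length; filter; cartesianProduct; allFin; tabulate)
open import Data.Nat.Base as ℕ using (ℕ; zero; suc; _%_; _≤_; _<_; _∸_; ⌊_/2⌋; ⌈_/2⌉; s≤s)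
open import Data.Nat.Induction using (<-rec)
open import Data.Nat.Properties as ℕ using (anyUpTo?)
open import Data.Product.Base using (∃-syntax; _×_; _,_; proj₁; proj₂)
open import Data.Sum.Base using (_⊎_; inj₁; inj₂)
open import Data.Vec.Base using (Vec; []; _∷_; head; last)
open import Data.Vec.Relation.Unary.All using (All; []; _∷_)
open import Data.Vec.Relation.Unary.AllPairs using ([]; _∷_)
open import Data.Vec.Relation.Unary.Linked using (Linked; [-]; _∷_)
open import Data.Vec.Relation.Unary.Unique.Propositional using (Unique)
open import Function.Base using (_∘_)
open import Level using (0ℓ)
open import Relation.Binary.Definitions using (tri<; tri≈; tri>)
open import Relation.Binary.PropositionalEquality.Core using (_≡_; _≢_; refl; sym; trans; cong; cong₂; subst)
open import Relation.Binary.PropositionalEquality.Properties using (module ≡-Reasoning)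
open import Relation.Nullary.Decidable using (Dec; yes; no; does; dec-true; dec-false)
open import Relation.Nullary.Negation using (¬_; contradiction)
open import Relation.Unary using (Pred; Decidable)

open Algebra.Properties.Semiring.Sum +-*-semiring
open ≡-Reasoning

-- Signs

-1^_ : ℕ → ℤ
-1^ zero    = 1ℤ
-1^ (suc k) = - (-1^ k)

-1^-+ : ∀ m n → -1^ (m ℕ.+ n) ≡ -1^ m * -1^ n
-1^-+ zero    n = sym (*-identityˡ (-1^ n))
-1^-+ (suc m) n = trans (cong -_ (-1^-+ m n)) (neg-distribˡ-* (-1^ m) (-1^ n))

-1^-square : ∀ k → -1^ k * -1^ k ≡ 1ℤ
-1^-square zero    = refl
-1^-square (suc k) = trans (neg*neg (-1^ k)) (-1^-square k)
  where
  neg*neg : ∀ i → - i * - i ≡ i * i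
  neg*neg = solve-∀

-- A sign is its own inverse, so removing `k` from the exponent multiplies by `-1^ k`, just as
-- adding it would.
-1^-∸ : ∀ {k n} → k ≤ n → -1^ (n ∸ k) ≡ -1^ n * -1^ k
-1^-∸ {k} {n} k≤n = begin
  -1^ (n ∸ k)                    ≡⟨ *-identityʳ _ ⟨
  -1^ (n ∸ k) * 1ℤ               ≡⟨ cong (-1^ (n ∸ k) *_) (-1^-square k) ⟨
  -1^ (n ∸ k) * (-1^ k * -1^ k)  ≡⟨ *-assoc (-1^ (n ∸ k)) (-1^ k) (-1^ k) ⟨
  -1^ (n ∸ k) * -1^ k * -1^ k    ≡⟨ cong (_* -1^ k) (-1^-+ (n ∸ k) k) ⟨
  -1^ (n ∸ k ℕ.+ k) * -1^ k      ≡⟨ cong (λ m → -1^ m * -1^ k) (ℕ.m∸n+n≡m k≤n) ⟩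
  -1^ n * -1^ k                  ∎

-1^-odd : ∀ n → n % 2 ≡ 1 → -1^ n ≡ -1ℤ
-1^-odd (suc zero)    _   = refl
-- `suc (suc n) % 2` reduces to `n % 2`, so `odd` serves the recursive call as it is.
-1^-odd (suc (suc n)) odd = cong (λ i → - (- i)) (-1^-odd n odd)

-- Sums

-- The Iverson bracket. It inspects only `does a?`, as `filter` does, so a single split on
-- `does (P? x)` reduces both.
⟦_⟧ : {A : Set} → Dec A → ℤ
⟦ a? ⟧ = if does a? then 1ℤ else 0ℤ

⟦⟧-true : {A : Set} (a? : Dec A) → A → ⟦ a? ⟧ ≡ 1ℤ
⟦⟧-true a? a = cong (if_then 1ℤ else 0ℤ) (dec-true a? a)

⟦⟧-false : {A : Set} (a? : Dec A) → ¬ A → ⟦ a? ⟧ ≡ 0ℤ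
⟦⟧-false a? ¬a = cong (if_then 1ℤ else 0ℤ) (dec-false a? ¬a)

∑-zero : ∀ {n} (f : Fin n → ℤ) → (∀ i → f i ≡ 0ℤ) → sum f ≡ 0ℤ
∑-zero {n} f f≗0 = trans (sum-cong-≗ f≗0) (sum-replicate-zero n)

∑-single : ∀ {n} (f : Fin n → ℤ) i → (∀ j → j ≢ i → f j ≡ 0ℤ) → sum f ≡ f i
∑-single f zero    f≡0 = begin
  f zero + sum (f ∘ suc)  ≡⟨ cong (_+_ (f zero)) (∑-zero (f ∘ suc) λ j → f≡0 (suc j) λ ()) ⟩
  f zero + 0ℤ             ≡⟨ +-identityʳ (f zero) ⟩
  f zero                  ∎
∑-single f (suc i) f≡0 = begin
  f zero + sum (f ∘ suc)  ≡⟨ cong (_+ sum (f ∘ suc)) (f≡0 zero λ ()) ⟩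
  0ℤ + sum (f ∘ suc)      ≡⟨ +-identityˡ _ ⟩
  sum (f ∘ suc)           ≡⟨ ∑-single (f ∘ suc) i (λ j j≢i → f≡0 (suc j) (j≢i ∘ Fin.suc-injective)) ⟩
  f (suc i)               ∎

∑-one : ∀ n → ∑[ i < n ] 1ℤ ≡ + n
∑-one zero    = refl
∑-one (suc n) = cong (_+_ 1ℤ) (∑-one n)

∑∑-cong : ∀ {m n} {f g : Fin m → Fin n → ℤ} → (∀ x y → f x y ≡ g x y) →
          ∑[ x < m ] ∑[ y < n ] f x y ≡ ∑[ x < m ] ∑[ y < n ] g x y
∑∑-cong f≗g = sum-cong-≗ λ x → sum-cong-≗ (f≗g x)

-- Sums over unordered pairs

≤-indicators : ∀ {n} (x y : Fin n) → ⟦ x Fin.≤? y ⟧ + ⟦ y Fin.≤? x ⟧ ≡ 1ℤ + ⟦ x ≟ y ⟧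
≤-indicators x y with ℕ.<-cmp (toℕ x) (toℕ y)
... | tri< x<y x≢y _ = trans
  (cong₂ _+_ (⟦⟧-true (x Fin.≤? y) (ℕ.<⇒≤ x<y)) (⟦⟧-false (y Fin.≤? x) (ℕ.<⇒≱ x<y)))
  (cong (_+_ 1ℤ) (sym (⟦⟧-false (x ≟ y) (x≢y ∘ cong toℕ))))
... | tri≈ _ x≡y _ = trans
  (cong₂ _+_ (⟦⟧-true (x Fin.≤? y) (ℕ.≤-reflexive x≡y)) (⟦⟧-true (y Fin.≤? x) (ℕ.≤-reflexive (sym x≡y))))
  (cong (_+_ 1ℤ) (sym (⟦⟧-true (x ≟ y) (toℕ-injective x≡y))))
... | tri> _ x≢y y<x = trans
  (cong₂ _+_ (⟦⟧-false (x Fin.≤? y) (ℕ.<⇒≱ y<x)) (⟦⟧-true (y Fin.≤? x) (ℕ.<⇒≤ y<x)))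
  (cong (_+_ 1ℤ) (sym (⟦⟧-false (x ≟ y) (x≢y ∘ cong toℕ))))

-- The condition `x ≤ y` is a weight in a full double sum rather than a bound on its range, which
-- keeps the summations interchangeable.
∑≤ : ∀ {n} → (Fin n → Fin n → ℤ) → ℤ
∑≤ {n} f = ∑[ x < n ] ∑[ y < n ] (⟦ x Fin.≤? y ⟧ * f x y)

-- Exchanging the summations turns the second copy into a sum over `y ≤ x`. By `≤-indicators`, the
-- two copies together cover the whole square once and the diagonal once more.
∑≤-double : ∀ {n} (s : Fin n → ℤ) →
  ∑≤ (λ x y → s x * s y) + ∑≤ (λ x y → s x * s y) ≡ sum s * sum s + ∑[ x < n ] (s x * s x)
∑≤-double {n} s = begin
  ∑≤ p + ∑≤ p
    ≡⟨ cong (_+_ (∑≤ p)) (∑-comm λ x y → ⟦ x Fin.≤? y ⟧ * p x y) ⟩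
  ∑≤ p + ∑[ x < n ] ∑[ y < n ] (⟦ y Fin.≤? x ⟧ * p y x)
    ≡⟨ ∑-distrib-+ (λ x → ∑[ y < n ] (⟦ x Fin.≤? y ⟧ * p x y)) (λ x → ∑[ y < n ] (⟦ y Fin.≤? x ⟧ * p y x)) ⟨
  ∑[ x < n ] (∑[ y < n ] (⟦ x Fin.≤? y ⟧ * p x y) + ∑[ y < n ] (⟦ y Fin.≤? x ⟧ * p y x))
    ≡⟨ sum-cong-≗ row ⟩
  ∑[ x < n ] (s x * sum s + s x * s x)
    ≡⟨ ∑-distrib-+ (λ x → s x * sum s) (λ x → s x * s x) ⟩
  ∑[ x < n ] (s x * sum s) + ∑[ x < n ] (s x * s x)
    ≡⟨ cong (_+ ∑[ x < n ] (s x * s x)) (*-distribʳ-sum (sum s) s) ⟨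
  sum s * sum s + ∑[ x < n ] (s x * s x) ∎
  where
  p : Fin n → Fin n → ℤ
  p x y = s x * s y

  collect : ∀ a b u v → a * (u * v) + b * (v * u) ≡ (a + b) * (u * v)
  collect = solve-∀

  expand : ∀ c u v → (1ℤ + c) * (u * v) ≡ u * v + c * (u * v)
  expand = solve-∀

  diagonal : ∀ x → ∑[ y < n ] (⟦ x ≟ y ⟧ * p x y) ≡ s x * s x
  diagonal x = begin
    ∑[ y < n ] (⟦ x ≟ y ⟧ * p x y)
      ≡⟨ ∑-single _ x (λ y y≢x → cong (_* p x y) (⟦⟧-false (x ≟ y) (y≢x ∘ sym))) ⟩
    ⟦ x ≟ x ⟧ * p x x  ≡⟨ cong (_* p x x) (⟦⟧-true (x ≟ x) refl) ⟩
    1ℤ * p x x         ≡⟨ *-identityˡ (p x x) ⟩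
    p x x              ∎

  row : ∀ x → ∑[ y < n ] (⟦ x Fin.≤? y ⟧ * p x y) + ∑[ y < n ] (⟦ y Fin.≤? x ⟧ * p y x)
              ≡ s x * sum s + s x * s x
  row x = begin
    ∑[ y < n ] (⟦ x Fin.≤? y ⟧ * p x y) + ∑[ y < n ] (⟦ y Fin.≤? x ⟧ * p y x)
      ≡⟨ ∑-distrib-+ (λ y → ⟦ x Fin.≤? y ⟧ * p x y) (λ y → ⟦ y Fin.≤? x ⟧ * p y x) ⟨
    ∑[ y < n ] (⟦ x Fin.≤? y ⟧ * p x y + ⟦ y Fin.≤? x ⟧ * p y x)
      ≡⟨ sum-cong-≗ (λ y → trans (collect ⟦ x Fin.≤? y ⟧ ⟦ y Fin.≤? x ⟧ (s x) (s y))
                          (trans (cong (_* p x y) (≤-indicators x y))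
                                 (expand ⟦ x ≟ y ⟧ (s x) (s y)))) ⟩
    ∑[ y < n ] (p x y + ⟦ x ≟ y ⟧ * p x y)
      ≡⟨ ∑-distrib-+ (p x) (λ y → ⟦ x ≟ y ⟧ * p x y) ⟩
    ∑[ y < n ] (p x y) + ∑[ y < n ] (⟦ x ≟ y ⟧ * p x y)
      ≡⟨ cong₂ _+_ (sym (*-distribˡ-sum (s x) s)) (diagonal x) ⟩
    s x * sum s + s x * s x ∎

-- With the sum over `k` innermost, each pair of vertices can be treated by itself.
∑-∑≤-comm : ∀ {m n} (c : Fin m → ℤ) (f : Fin m → Fin n → Fin n → ℤ) →
  ∑[ k < m ] (c k * ∑≤ (f k)) ≡ ∑≤ (λ x y → ∑[ k < m ] (c k * f k x y))
∑-∑≤-comm {m} {n} c f = begin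
  ∑[ k < m ] (c k * ∑≤ (f k))
    ≡⟨ sum-cong-≗ (λ k → trans (*-distribˡ-sum (c k) (λ x → ∑[ y < n ] (⟦ x Fin.≤? y ⟧ * f k x y)))
         (sum-cong-≗ λ x → trans (*-distribˡ-sum (c k) (λ y → ⟦ x Fin.≤? y ⟧ * f k x y))
         (sum-cong-≗ λ y → exchange (c k) ⟦ x Fin.≤? y ⟧ (f k x y)))) ⟩
  ∑[ k < m ] ∑[ x < n ] ∑[ y < n ] (⟦ x Fin.≤? y ⟧ * (c k * f k x y))
    ≡⟨ ∑-comm (λ k x → ∑[ y < n ] (⟦ x Fin.≤? y ⟧ * (c k * f k x y))) ⟩
  ∑[ x < n ] ∑[ k < m ] ∑[ y < n ] (⟦ x Fin.≤? y ⟧ * (c k * f k x y))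
    ≡⟨ sum-cong-≗ (λ x → ∑-comm (λ k y → ⟦ x Fin.≤? y ⟧ * (c k * f k x y))) ⟩
  ∑[ x < n ] ∑[ y < n ] ∑[ k < m ] (⟦ x Fin.≤? y ⟧ * (c k * f k x y))
    ≡⟨ ∑∑-cong (λ x y → *-distribˡ-sum ⟦ x Fin.≤? y ⟧ (λ k → c k * f k x y)) ⟨
  ∑≤ (λ x y → ∑[ k < m ] (c k * f k x y)) ∎
  where
  exchange : ∀ a b d → a * (b * d) ≡ b * (a * d)
  exchange = solve-∀

-- Sums over lists

∑ˡ : {A : Set} → (A → ℤ) → List A → ℤ
∑ˡ f []       = 0ℤ
∑ˡ f (x ∷ xs) = f x + ∑ˡ f xs

∑ˡ-++ : {A : Set} (f : A → ℤ) (xs ys : List A) → ∑ˡ f (xs ++ ys) ≡ ∑ˡ f xs + ∑ˡ f ys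
∑ˡ-++ f []       ys = sym (+-identityˡ _)
∑ˡ-++ f (x ∷ xs) ys = trans (cong (_+_ (f x)) (∑ˡ-++ f xs ys)) (sym (+-assoc (f x) _ _))

∑ˡ-map : {A B : Set} (f : B → ℤ) (g : A → B) (xs : List A) → ∑ˡ f (List.map g xs) ≡ ∑ˡ (f ∘ g) xs
∑ˡ-map f g []       = refl
∑ˡ-map f g (x ∷ xs) = cong (_+_ (f (g x))) (∑ˡ-map f g xs)

∑ˡ-tabulate : ∀ {A : Set} {n} (f : A → ℤ) (g : Fin n → A) → ∑ˡ f (tabulate g) ≡ ∑[ i < n ] f (g i)
∑ˡ-tabulate {n = zero}  f g = refl
∑ˡ-tabulate {n = suc n} f g = cong (_+_ (f (g zero))) (∑ˡ-tabulate f (g ∘ suc))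

∑ˡ-cartesianProduct : {A B : Set} (f : A × B → ℤ) (xs : List A) (ys : List B) →
  ∑ˡ f (cartesianProduct xs ys) ≡ ∑ˡ (λ x → ∑ˡ (λ y → f (x , y)) ys) xs
∑ˡ-cartesianProduct f []       ys = refl
∑ˡ-cartesianProduct f (x ∷ xs) ys = trans
  (∑ˡ-++ f (List.map (x ,_) ys) (cartesianProduct xs ys))
  (cong₂ _+_ (∑ˡ-map f (x ,_) ys) (∑ˡ-cartesianProduct f xs ys))

∑ˡ-filter : {A : Set} {P : Pred A 0ℓ} (P? : Decidable P) (f : A → ℤ) (xs : List A) →
  ∑ˡ f (filter P? xs) ≡ ∑ˡ (λ x → ⟦ P? x ⟧ * f x) xs
∑ˡ-filter P? f []       = refl
∑ˡ-filter P? f (x ∷ xs) with does (P? x)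
... | false = trans (∑ˡ-filter P? f xs) (sym (trans (cong (_+ ∑ˡ (λ y → ⟦ P? y ⟧ * f y) xs) (*-zeroˡ (f x))) (+-identityˡ _)))
... | true  = cong₂ _+_ (sym (*-identityˡ (f x))) (∑ˡ-filter P? f xs)

length-filter : {A : Set} {P : Pred A 0ℓ} (P? : Decidable P) (xs : List A) →
  + length (filter P? xs) ≡ ∑ˡ (λ x → ⟦ P? x ⟧) xs
length-filter P? []       = refl
length-filter P? (x ∷ xs) with does (P? x)
... | false = trans (length-filter P? xs) (sym (+-identityˡ _))
... | true  = cong (_+_ 1ℤ) (length-filter P? xs)

-- Walks and distances

module _ {n : ℕ} (G : Graph n) where
  open Graph G

  -- `α` measures a list filtered twice: the filter by distance becomes the summand, and the filter
  -- in `unorderedPairs` becomes the weight of `∑≤`.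
  α-∑≤ : ∀ k → + α G k ≡ ∑≤ (λ x y → ⟦ distance? G x y k ⟧)
  α-∑≤ k = begin
    + α G k
      ≡⟨ length-filter _ (unorderedPairs G) ⟩
    ∑ˡ (λ (x , y) → ⟦ distance? G x y k ⟧) (unorderedPairs G)
      ≡⟨ ∑ˡ-filter _ (λ (x , y) → ⟦ distance? G x y k ⟧) (cartesianProduct (allFin n) (allFin n)) ⟩
    ∑ˡ (λ (x , y) → f x y) (cartesianProduct (allFin n) (allFin n))
      ≡⟨ ∑ˡ-cartesianProduct (λ (x , y) → f x y) (allFin n) (allFin n) ⟩
    ∑ˡ (λ x → ∑ˡ (f x) (allFin n)) (allFin n)
      ≡⟨ ∑ˡ-tabulate (λ x → ∑ˡ (f x) (allFin n)) (λ x → x) ⟩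
    ∑[ x < n ] ∑ˡ (f x) (allFin n)
      ≡⟨ sum-cong-≗ (λ x → ∑ˡ-tabulate (f x) (λ y → y)) ⟩
    ∑≤ (λ x y → ⟦ distance? G x y k ⟧) ∎
    where
    f : Fin n → Fin n → ℤ
    f x y = ⟦ x Fin.≤? y ⟧ * ⟦ distance? G x y k ⟧

  -- Unlike `Path`, a walk may repeat vertices, so walks can be concatenated and closed up freely.
  data Walk : Fin n → Fin n → ℕ → Set where
    []  : ∀ {x} → Walk x x 0
    _∷_ : ∀ {x y z k} → Adj x y → Walk y z k → Walk x z (suc k)

  _++ʷ_ : ∀ {x y z k l} → Walk x y k → Walk y z l → Walk x z (k ℕ.+ l)
  []      ++ʷ v = v
  (a ∷ w) ++ʷ v = a ∷ (w ++ʷ v)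

  reverseʷ : ∀ {x y k} → Walk x y k → Walk y x k
  reverseʷ []                  = []
  reverseʷ (_∷_ {k = k} a w) =
    subst (Walk _ _) (ℕ.+-comm k 1) (reverseʷ w ++ʷ (adj-sym a ∷ []))

  linked⇒walk : ∀ {k} (v : Vec (Fin n) (suc k)) → Linked Adj v → Walk (head v) (last v) k
  linked⇒walk (x ∷ [])     [-]     = []
  linked⇒walk (x ∷ y ∷ v) (a ∷ l) = a ∷ linked⇒walk (y ∷ v) l

  path⇒walk : ∀ {x y k} → Path G x y k → Walk x y k
  path⇒walk (v , refl , refl , linked , _) = linked⇒walk v linked

  -- Leaving out the first vertex makes `vertices w` a cons without matching on `w`, so its head
  -- computes to the starting point.
  later : ∀ {x y k} → Walk x y k → Vec (Fin n) k
  later []                  = []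
  later (_∷_ {y = y} a w) = y ∷ later w

  vertices : ∀ {x y k} → Walk x y k → Vec (Fin n) (suc k)
  vertices {x} w = x ∷ later w

  last-vertices : ∀ {x y k} (w : Walk x y k) → last (vertices w) ≡ y
  last-vertices []      = refl
  last-vertices (a ∷ w) = last-vertices w

  vertices-linked : ∀ {x y k} (w : Walk x y k) → Linked Adj (vertices w)
  vertices-linked []      = [-]
  vertices-linked (a ∷ w) = a ∷ vertices-linked w

  -- The walk is cut at its first visit to `z`, if there is one.
  avoids-or-visits : ∀ z {x y k} (w : Walk x y k) →
    All (z ≢_) (vertices w) ⊎ ∃[ i ] ∃[ j ] (Walk x z i × Walk z y j × i ℕ.+ j ≡ k)
  avoids-or-visits z {x} w with z ≟ x
  ... | yes refl = inj₂ (_ , _ , [] , w , refl)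
  avoids-or-visits z []      | no z≢x = inj₁ (z≢x ∷ [])
  avoids-or-visits z (a ∷ w) | no z≢x with avoids-or-visits z w
  ... | inj₁ avoids                  = inj₁ (z≢x ∷ avoids)
  ... | inj₂ (i , j , u , v , refl) = inj₂ (suc i , j , a ∷ u , v , refl)

  -- A loop found in the tail is kept, and the first edge joins the remainder. If the tail has no
  -- repetition, only `x` can recur, and then the part up to its return is the loop. The length
  -- `suc i` records that the loop is nonempty.
  unique-or-loop : ∀ {x y k} (w : Walk x y k) →
    Unique (vertices w) ⊎ ∃[ z ] ∃[ i ] ∃[ j ] (Walk z z (suc i) × Walk x y j × suc i ℕ.+ j ≡ k)
  unique-or-loop []                = inj₁ ([] ∷ [])
  unique-or-loop (_∷_ {x} a w) with unique-or-loop w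
  ... | inj₂ (z , i , j , loop , u , refl) = inj₂ (z , i , suc j , loop , a ∷ u , cong suc (ℕ.+-suc i j))
  ... | inj₁ unique with avoids-or-visits x w
  ...   | inj₁ avoids                  = inj₁ (avoids ∷ unique)
  ...   | inj₂ (i , j , u , v , refl) = inj₂ (x , i , j , a ∷ u , v , refl)

  -- A closed walk either is a cycle or splits at a repeated vertex into two
  -- shorter closed walks.
  closed-walk-even : Acyclic G → ∀ k {x} → Walk x x k → -1^ k ≡ 1ℤ
  closed-walk-even acyclic = <-rec (λ k → ∀ {x} → Walk x x k → -1^ k ≡ 1ℤ) step
    where
    step : ∀ k → (∀ {j} → j < k → ∀ {x} → Walk x x j → -1^ j ≡ 1ℤ) → ∀ {x} → Walk x x k → -1^ k ≡ 1ℤ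
    step zero    rec []      = refl
    -- Only the tail is tested, since a closed walk always repeats its first vertex at the end.
    -- Keeping `a` out of the loop also makes both pieces strictly shorter than the whole.
    step (suc k) rec {x} (_∷_ {y = y} a w) with unique-or-loop w
    ... | inj₂ (z , i , j , loop , u , refl) = begin
      -1^ (suc (suc i ℕ.+ j))    ≡⟨ cong (λ l → -1^ l) (ℕ.+-suc (suc i) j) ⟨
      -1^ (suc i ℕ.+ suc j)      ≡⟨ -1^-+ (suc i) (suc j) ⟩
      -1^ (suc i) * -1^ (suc j)  ≡⟨ cong₂ _*_ (rec (s≤s (ℕ.m≤m+n (suc i) j)) loop)
                                              (rec (s≤s (s≤s (ℕ.m≤n+m j i))) (a ∷ u)) ⟩
      1ℤ                         ∎
    -- `IsCycle` starts at three vertices, so lengths one and two are settled directly: the first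
    -- would be an edge from a vertex to itself, the second is even.
    step (suc zero)          rec (a ∷ [])     | inj₁ _      = contradiction a (adj-irrefl refl)
    step (suc (suc zero))    rec (a ∷ w)      | inj₁ _      = refl
    -- The tail runs from `y` to `x` through distinct vertices, and the edge `a` closes it to a
    -- cycle.
    step (suc (suc (suc k))) rec {x} (_∷_ {y = y} a w) | inj₁ unique = contradiction
      (vertices-linked w , subst (λ v → Adj v y) (sym (last-vertices w)) a , unique)
      (acyclic (vertices w))

  -- Descends to a shorter path as long as the bounded search finds one; when it fails, the current
  -- path is shortest.
  path⇒distance : ∀ {x y} k → Path G x y k → ∃[ d ] Distance G x y d
  path⇒distance {x} {y} = <-rec (λ k → Path G x y k → ∃[ d ] Distance G x y d) step
    where
    step : ∀ k → (∀ {j} → j < k → Path G x y j → ∃[ d ] Distance G x y d) →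
           Path G x y k → ∃[ d ] Distance G x y d
    step k rec p with anyUpTo? (path? G x y) k
    ... | yes (j , j<k , q) = rec j<k q
    ... | no ¬shorter       = k , p , λ q → ℕ.≮⇒≥ λ j<k → ¬shorter (_ , j<k , q)

  distance-unique : ∀ {x y k l} → Distance G x y k → Distance G x y l → k ≡ l
  distance-unique (p , p-min) (q , q-min) = ℕ.≤-antisym (p-min q) (q-min p)

  -- Palindromicity and the alternating sum

  HPalindromic-sym : ∀ {D} → HPalindromic G D → ∀ {k} → k ≤ D → α G k ≡ α G (D ∸ k)
  HPalindromic-sym {D} pal {k} k≤D with k ℕ.≤? ⌊ D /2⌋
  ... | yes k≤D/2 = pal k k≤D/2
  -- In the upper half, the hypothesis is applied to `D ∸ k` and read from right to left.
  ... | no  k≰D/2 = begin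
    α G k              ≡⟨ cong (α G) (ℕ.m∸[m∸n]≡n k≤D) ⟨
    α G (D ∸ (D ∸ k))  ≡⟨ pal (D ∸ k) D∸k≤D/2 ⟨
    α G (D ∸ k)        ∎
    where
    ⌈D/2⌉≤k : ⌈ D /2⌉ ≤ k
    -- `⌈ D /2⌉` is `⌊ suc D /2⌋`, at most `⌊ suc (suc D) /2⌋`, which reduces to `suc ⌊ D /2⌋`.
    ⌈D/2⌉≤k = ℕ.≤-trans (ℕ.⌊n/2⌋-mono (ℕ.n≤1+n (suc D))) (ℕ.≰⇒> k≰D/2)

    D∸k≤D/2 : D ∸ k ≤ ⌊ D /2⌋
    D∸k≤D/2 = ℕ.m≤n+o⇒m∸n≤o D k (ℕ.≤-trans
      (ℕ.≤-reflexive (trans (sym (ℕ.⌊n/2⌋+⌈n/2⌉≡n D)) (ℕ.+-comm ⌊ D /2⌋ ⌈ D /2⌉)))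
      (ℕ.+-monoˡ-≤ ⌊ D /2⌋ ⌈D/2⌉≤k))

  -- For `D` the diameter, this is the Hosoya polynomial, with coefficients `α G k`, evaluated at
  -- -1.
  alternating-sum : ℕ → ℤ
  alternating-sum D = ∑[ k ≤ D ] (-1^ toℕ k * + α G (toℕ k))

  -- Reversing the order of summation keeps each `α` and multiplies each sign by `-1^ D`, so the sum
  -- equals its own negative.
  alternating-sum-palindromic : ∀ {D} → D % 2 ≡ 1 → HPalindromic G D → alternating-sum D ≡ 0ℤ
  alternating-sum-palindromic {D} odd pal = self-negative (alternating-sum D) (begin
    alternating-sum D
      ≡⟨ ∑-permute term reverse ⟩
    ∑[ k ≤ D ] term (opposite k)
      ≡⟨ sum-cong-≗ reflect ⟩
    ∑[ k ≤ D ] (-1ℤ * term k)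
      ≡⟨ *-distribˡ-sum -1ℤ term ⟨
    -1ℤ * alternating-sum D
      ≡⟨ -1*i≡-i (alternating-sum D) ⟩
    - alternating-sum D ∎)
    where
    self-negative : ∀ i → i ≡ - i → i ≡ 0ℤ
    -- A nonzero integer and its negative have different constructors, so the other cases are
    -- absurd.
    self-negative (+ zero) _ = refl

    term : Fin (suc D) → ℤ
    term k = -1^ toℕ k * + α G (toℕ k)

    reflect : ∀ k → term (opposite k) ≡ -1ℤ * term k
    reflect k = begin
      term (opposite k)
        ≡⟨ cong (λ l → -1^ l * + α G l) (opposite-prop k) ⟩
      -1^ (D ∸ toℕ k) * + α G (D ∸ toℕ k)
        ≡⟨ cong₂ (λ i a → i * + a) (-1^-∸ k≤D) (sym (HPalindromic-sym pal k≤D)) ⟩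
      -1^ D * -1^ toℕ k * + α G (toℕ k)
        ≡⟨ *-assoc (-1^ D) (-1^ toℕ k) (+ α G (toℕ k)) ⟩
      -1^ D * term k
        ≡⟨ cong (_* term k) (-1^-odd D odd) ⟩
      -1ℤ * term k ∎
      where
      k≤D : toℕ k ≤ D
      k≤D = toℕ≤pred[n] k

  -- Parity of distances in a tree

  module _ (tree : IsTree G) (r : Fin n) where
    open IsTree tree

    -- A two-colouring by the parity of whichever path from `r` is supplied by `connected`; no
    -- minimality of that path is involved.
    s : Fin n → ℤ
    s x = -1^ proj₁ (connected r x)

    s-square : ∀ x → s x * s x ≡ 1ℤ
    s-square x = -1^-square (proj₁ (connected r x))

    -- Going from `r` to `x`, on to `y` and back to `r` is a closed walk, so the product of the
    -- three signs is 1. Inserting the squares of `s x` and `s y` isolates that product.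
    -1^-distance : ∀ {x y d} → Distance G x y d → -1^ d ≡ s x * s y
    -1^-distance {x} {y} {d} (p , _) = begin
      -1^ d                                ≡⟨ *-identityʳ (-1^ d) ⟨
      -1^ d * 1ℤ                           ≡⟨ cong₂ (λ i j → -1^ d * (i * j)) (s-square x) (s-square y) ⟨
      -1^ d * ((s x * s x) * (s y * s y))  ≡⟨ regroup (-1^ d) (s x) (s y) ⟩
      s x * (-1^ d * s y) * (s x * s y)    ≡⟨ cong (_* (s x * s y)) closed ⟩
      1ℤ * (s x * s y)                     ≡⟨ *-identityˡ (s x * s y) ⟩
      s x * s y                            ∎
      where
      regroup : ∀ e u v → e * ((u * u) * (v * v)) ≡ u * (e * v) * (u * v)
      regroup = solve-∀

      k l : ℕ
      k = proj₁ (connected r x)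
      l = proj₁ (connected r y)

      closed : s x * (-1^ d * s y) ≡ 1ℤ
      closed = begin
        s x * (-1^ d * s y)       ≡⟨ cong (s x *_) (-1^-+ d l) ⟨
        s x * -1^ (d ℕ.+ l)       ≡⟨ -1^-+ k (d ℕ.+ l) ⟨
        -1^ (k ℕ.+ (d ℕ.+ l))     ≡⟨ closed-walk-even acyclic _
          (path⇒walk (proj₂ (connected r x)) ++ʷ (path⇒walk p ++ʷ reverseʷ (path⇒walk (proj₂ (connected r y))))) ⟩
        1ℤ                        ∎

    -- Connectedness gives a distance, the diameter bounds it by `D`, and it is unique, so exactly
    -- one term survives.
    ∑-distance : ∀ {D} → HasDiameter G D → ∀ x y →
      ∑[ k ≤ D ] (-1^ toℕ k * ⟦ distance? G x y (toℕ k) ⟧) ≡ s x * s y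
    ∑-distance {D} (_ , bound) x y with path⇒distance _ (proj₂ (connected x y))
    ... | d , dist = begin
      ∑[ k ≤ D ] term (toℕ k)  ≡⟨ ∑-single (term ∘ toℕ) i (λ k k≢i → trans
                                    (cong (-1^ toℕ k *_) (⟦⟧-false (distance? G x y (toℕ k))
                                      λ dist′ → k≢i (toℕ-injective (trans (distance-unique dist′ dist) (sym i≡d)))))
                                    (*-zeroʳ (-1^ toℕ k))) ⟩
      term (toℕ i)             ≡⟨ cong term i≡d ⟩
      term d                   ≡⟨ cong (-1^ d *_) (⟦⟧-true (distance? G x y d) dist) ⟩
      -1^ d * 1ℤ               ≡⟨ *-identityʳ (-1^ d) ⟩
      -1^ d                    ≡⟨ -1^-distance dist ⟩
      s x * s y                ∎
      where
      term : ℕ → ℤ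
      term k = -1^ k * ⟦ distance? G x y k ⟧

      i : Fin (suc D)
      i = fromℕ< (s≤s (bound dist))

      i≡d : toℕ i ≡ d
      i≡d = toℕ-fromℕ< (s≤s (bound dist))

    alternating-sum-∑≤ : ∀ {D} → HasDiameter G D → alternating-sum D ≡ ∑≤ (λ x y → s x * s y)
    alternating-sum-∑≤ {D} diam = begin
      ∑[ k ≤ D ] (-1^ toℕ k * + α G (toℕ k))
        ≡⟨ sum-cong-≗ {suc D} (λ k → cong (-1^ toℕ k *_) (α-∑≤ (toℕ k))) ⟩
      ∑[ k ≤ D ] (-1^ toℕ k * ∑≤ (λ x y → ⟦ distance? G x y (toℕ k) ⟧))
        ≡⟨ ∑-∑≤-comm {suc D} (λ k → -1^ toℕ k) (λ k x y → ⟦ distance? G x y (toℕ k) ⟧) ⟩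
      ∑≤ (λ x y → ∑[ k ≤ D ] (-1^ toℕ k * ⟦ distance? G x y (toℕ k) ⟧))
        ≡⟨ ∑∑-cong (λ x y → cong (⟦ x Fin.≤? y ⟧ *_) (∑-distance diam x y)) ⟩
      ∑≤ (λ x y → s x * s y) ∎

    -- The right side is the image of a natural number, so that once it vanishes, its summand `n`
    -- must vanish too.
    alternating-sum-double : ∀ {D} → HasDiameter G D →
      alternating-sum D + alternating-sum D ≡ + (∣ sum s ∣ ℕ.* ∣ sum s ∣ ℕ.+ n)
    alternating-sum-double {D} diam = begin
      alternating-sum D + alternating-sum D
        ≡⟨ cong₂ _+_ (alternating-sum-∑≤ diam) (alternating-sum-∑≤ diam) ⟩
      ∑≤ (λ x y → s x * s y) + ∑≤ (λ x y → s x * s y)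
        ≡⟨ ∑≤-double s ⟩
      sum s * sum s + ∑[ x < n ] (s x * s x)
        ≡⟨ cong₂ _+_ (square (sum s)) (trans (sum-cong-≗ s-square) (∑-one n)) ⟩
      + (∣ sum s ∣ ℕ.* ∣ sum s ∣ ℕ.+ n) ∎
      where
      square : ∀ i → i * i ≡ + (∣ i ∣ ℕ.* ∣ i ∣)
      square (+ zero)   = refl
      square +[1+ _ ]   = refl
      square (-[1+ _ ]) = refl

corollary1 : ∀ {n : ℕ} (T : Graph n) → IsTree T →
    ∀ (D : ℕ) → HasDiameter T D → D % 2 ≡ 1 → ¬ HPalindromic T D
-- The vertex `r` realizing the diameter is both the root for the signs and the element of `Fin n`
-- that contradicts `n ≡ 0`.
corollary1 {n} T tree D diam@((r , _) , _) odd pal = contradiction (subst Fin n≡0 r) Fin.¬Fin0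
  where
  Z≡0 : alternating-sum T D ≡ 0ℤ
  Z≡0 = alternating-sum-palindromic T odd pal

  n≡0 : n ≡ 0
  n≡0 = ℕ.m+n≡0⇒n≡0 _ (+-injective
    (trans (sym (alternating-sum-double T tree r diam)) (cong₂ _+_ Z≡0 Z≡0)))
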